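{- For every function $f:\mathbb{N}\to\mathbb{N}$ there is a graph $G$ such that $|G| = 2^{\aleph_1}$, $\chi(G)=\aleph_1$, and for every natural number $k\ge 3$ we have $f_G(k)\ge f(k)$; that is, every subgraph of $G$ with fewer than $f(k)$ vertices has chromatic number less than $k$.
   Context: Graphs are simple undirected graphs (no loops); $|G|$ denotes the number of vertices and $\chi(G)$ the chromatic number. For a graph $G$ with infinite chromatic number and $k\in\mathbb{N}$, $f_G(k)$ is the least natural number $m$ such that $G$ has a subgraph with $m$ vertices and chromatic number at least $k$ (this exists by the De Bruijn–Erdős compactness theorem). $\mathbb{N}$ includes $0$. -}

module Defs where

open import Data.Bool.Base using (Bool)
open import Data.Fin.Base using (Fin)
open import Data.Nat.Base using (ℕ; _≤_)
open import Data.Product using (Σ; Σ-syntax; _×_; proj₁)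
open import Function.Base using (_on_)
open import Function.Bundles using (_↣_; _↔_)
open import Level using (0ℓ)
open import Relation.Binary.Core using (Rel; _⇒_)
open import Relation.Binary.Definitions using (Symmetric; Irreflexive)
open import Relation.Binary.PropositionalEquality using (_≡_; _≢_; cong)
open import Relation.Nullary using (¬_)
open import Relation.Unary using (Pred; Irrelevant)

-- A cardinal is represented by any type of that cardinality: equality
-- of cardinals is _↔_ and their order is _↣_.  These notions are meant
-- to be read under the axioms ExcludedMiddle and Extensionality.  The
-- former decides P itself rather than a truncation, so it picks an
-- element of every non-empty type; by the latter such picks respect
-- equality of subsets A → Bool, which gives the axiom of choice.

_<ᶜ_ : Set → Set → Set
A <ᶜ B = (A ↣ B) × ¬ (B ↣ A)

IsAleph₁ : Set → Set₁
IsAleph₁ A = (ℕ <ᶜ A) × (∀ (B : Set) → ℕ <ᶜ B → A ↣ B)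

2^_ : Set → Set
2^ A = A → Bool

-- Adjacency is only ever used as a proposition: u and v are joined by
-- an edge when u ~ v is inhabited, so no multiplicity is recorded.

record Graph : Set₁ where
  field
    Vertex : Set
    _~_    : Rel Vertex 0ℓ
    ~-sym    : Symmetric _~_
    ~-irrefl : Irreflexive _≡_ _~_

open Graph public using (Vertex)

-- A subgraph need not be induced.  Irrelevance of _∈V makes
-- Σ Vertex _∈V a subset, so that its cardinality is the number of
-- vertices.

record Subgraph (G : Graph) : Set₁ where
  open Graph G using (_~_; ~-irrefl)
  field
    _∈V    : Pred (Vertex G) 0ℓ
    ∈V-irr : Irrelevant _∈V
    _~′_   : Rel (Σ (Vertex G) _∈V) 0ℓ
    ~′⇒~   : _~′_ ⇒ (_~_ on proj₁)
    ~′-sym : Symmetric _~′_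

  graph : Graph
  graph = record
    { Vertex   = Σ (Vertex G) _∈V
    ; _~_      = _~′_
    ; ~-sym    = ~′-sym
    ; ~-irrefl = λ u≡v u~v → ~-irrefl (cong proj₁ u≡v) (~′⇒~ u~v)
    }

open Subgraph public using (graph)

Colouring : Graph → Set → Set
Colouring G C = Σ[ c ∈ (Vertex G → C) ] (∀ {u v} → u ~ v → c u ≢ c v)
  where open Graph G using (_~_)

-- The chromatic number is a cardinal; it is given as a relation because
-- its existence for every graph relies on the classical axioms.

χ_≔_ : Graph → Set → Set₁
χ G ≔ κ = Colouring G κ × (∀ (C : Set) → Colouring G C → κ ↣ C)

χ_≥_ : Graph → ℕ → Set₁
χ G ≥ k = Σ[ κ ∈ Set ] (χ G ≔ κ) × (Fin k ↣ κ)

χ_<_ : Graph → ℕ → Set₁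
χ G < k = Σ[ κ ∈ Set ] (χ G ≔ κ) × (κ <ᶜ Fin k)

HasOrder : Graph → ℕ → Set
HasOrder G m = Vertex G ↔ Fin m

HasSubgraph : Graph → ℕ → ℕ → Set₁
HasSubgraph G k m =
  Σ[ H ∈ Subgraph G ] HasOrder (graph H) m × (χ graph H ≥ k)

-- A relation, since the existence of a value is the De Bruijn–Erdős
-- theorem.

f[_]_≔_ : Graph → ℕ → ℕ → Set₁
f[ G ] k ≔ m = HasSubgraph G k m × (∀ n → HasSubgraph G k n → m ≤ n)

{-# OPTIONS --safe #-}
module Submission where

open import Defs
open import Axiom.ExcludedMiddle using (ExcludedMiddle)
open import Axiom.Extensionality.Propositional using (Extensionality; implicit-extensionality)
open import Data.Bool.Base using (Bool; true; false; not)
open import Data.Bool.Properties using (not-involutive; ¬-not)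
open import Data.Empty using (⊥; ⊥-elim)
open import Data.Fin.Base using (Fin; zero; suc; toℕ; fromℕ<; inject≤; combine; funToFin; finToFun)
open import Data.Fin.Properties
  using (2↔Bool; toℕ-injective; toℕ-fromℕ<; fromℕ<-injective; inject≤-injective; injective⇒≤;
         combine-injective; finToFun-funToFin)
open import Data.List.Base using (List; []; _∷_; _++_; length; replicate; map; allFin)
open import Data.List.Membership.Propositional using (_∈_)
open import Data.List.Membership.Propositional.Properties using (∈-++⁺ˡ; ∈-++⁺ʳ; ∈-map⁺; ∈-allFin)
open import Data.List.Properties using (++-assoc; length-++; length-map; length-tabulate)
open import Data.List.Relation.Unary.Any using (here; there)
open import Data.Nat.Base hiding (parity)
open import Data.Nat.Induction using (<-wellFounded)
open import Data.Nat.Properties hiding (≡-irrelevant)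
open import Data.Nat.Solver using (module +-*-Solver)
open import Data.Product using (Σ-syntax; ∃; ∃-syntax; ∃₂; _×_; _,_; proj₁; proj₂; map₂)
open import Data.Product.Relation.Binary.Lex.Strict using (×-Lex; ×-wellFounded)
open import Data.Sum.Base using (_⊎_; inj₁; inj₂; [_,_]′; swap)
open import Data.Unit.Base using (⊤; tt)
open import Function.Base using (_∘_; _on_; _$_; id)
open import Function.Bundles using (_↣_; _↔_; mk↣; mk↔ₛ′; mk⇔; module Injection; module Inverse)
open import Function.Construct.Composition using (_↣-∘_)
open import Function.Construct.Identity using (↔-id)
open import Function.Definitions using (Injective)
open import Function.Properties.Inverse using (↔-sym; ↔⇒↣)
open import Induction.WellFounded
  using (WellFounded; Acc; acc; wf⇒asym; module All; module FixPoint)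
open import Level using (0ℓ)
open import Relation.Binary.Construct.On as On using ()
open import Relation.Binary.Core using (Rel)
open import Relation.Binary.Definitions using (tri<; tri≈; tri>; Transitive; Symmetric)
open import Relation.Binary.PropositionalEquality
  using (_≡_; _≢_; refl; sym; trans; cong; cong₂; subst; subst₂)
open import Relation.Binary.PropositionalEquality.WithK using (≡-irrelevant)
open import Relation.Nullary using (¬_; Dec; yes; no; does)
open import Relation.Nullary.Decidable using (decidable-stable; dec-true; does-⇔)

-- A vertex codes a sequence of countable ordinals, whose first term
-- names a real.  Sequences are joined with index n when their reals
-- differ at bit n and their remaining terms interlace according to n + 1
-- successive patterns.
--
-- The m-th pattern excludes short odd cycles from the edges of index at
-- least m, so these two-colour a small subgraph, and the first m bits
-- properly colour the other edges: 2 · 2^m colours suffice.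
--
-- Given a colouring with countably many colours, for each real some
-- colour is used on a large set of sequences, since the small ones form
-- a σ-ideal.  Two of the uncountably many reals get the same colour, and
-- sequences from two large sets can be interlaced in any finite pattern,
-- so the colouring is not proper.  The same argument on ω in place of ω₁
-- with finitely many colours, plus compactness for countable graphs,
-- gives finite subgraphs of every finite chromatic number.

dec-true⁻¹ : {P : Set} (P? : Dec P) → does P? ≡ true → P
dec-true⁻¹ (yes p) _ = p

-- Coding lists of natural numbers.

pair : ℕ → ℕ → ℕ
pair a b = (a + b) * (a + b) + a

-- Since `a ≤ a + b`, the code lies from the square of `a + b` up to, but not at, the next square,
-- so codes with different sums cannot meet.
pair-mono : ∀ a b c d → a + b < c + d → pair a b < pair c d
pair-mono a b c d s<t = begin-strict
  s * s + a  ≤⟨ +-monoʳ-≤ (s * s) (m≤m+n a b) ⟩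
  s * s + s  ≡⟨ +-comm (s * s) s ⟩
  suc s * s  <⟨ *-monoʳ-< (suc s) (n<1+n s) ⟩
  suc s * suc s  ≤⟨ *-mono-≤ s<t s<t ⟩
  (c + d) * (c + d)  ≤⟨ m≤m+n _ c ⟩
  pair c d  ∎
  where
  open ≤-Reasoning
  s = a + b

pair-injective : ∀ {a b c d} → pair a b ≡ pair c d → a ≡ c × b ≡ d
pair-injective {a} {b} {c} {d} eq with <-cmp (a + b) (c + d)
... | tri< lt _ _ = ⊥-elim (<⇒≢ (pair-mono a b c d lt) eq)
... | tri> _ _ gt = ⊥-elim (<⇒≢ (pair-mono c d a b gt) (sym eq))
... | tri≈ _ s≡t _ with refl ← +-cancelˡ-≡ ((c + d) * (c + d)) a c
                     (trans (cong (λ s → s * s + a) (sym s≡t)) eq)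
  = refl , +-cancelˡ-≡ a b d s≡t

encode : List ℕ → ℕ
encode []      = zero
encode (a ∷ l) = suc (pair a (encode l))

encode-injective : ∀ {k l} → encode k ≡ encode l → k ≡ l
encode-injective {[]}    {[]}    _  = refl
encode-injective {a ∷ k} {b ∷ l} eq =
  let a≡b , k≡l = pair-injective {a} {encode k} {b} {encode l} (suc-injective eq)
  in cong₂ _∷_ a≡b (encode-injective k≡l)

-- Brouwer trees, compared by rank: the rank of node f is the least
-- ordinal above the ranks of all f n.

data Tree : Set where
  leaf : Tree
  node : (ℕ → Tree) → Tree

infix 4 _≤ᵗ_ _<ᵗ_ _≈ᵗ_

_≤ᵗ_ _<ᵗ_ _≈ᵗ_ : Tree → Tree → Set
leaf   ≤ᵗ y = ⊤
node f ≤ᵗ y = ∀ n → f n <ᵗ y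
x <ᵗ leaf   = ⊥
x <ᵗ node g = ∃ λ n → x ≤ᵗ g n
x ≈ᵗ y = x ≤ᵗ y × y ≤ᵗ x

≤ᵗ-refl : ∀ x → x ≤ᵗ x
≤ᵗ-refl leaf       = tt
≤ᵗ-refl (node f) n = n , ≤ᵗ-refl (f n)

mutual
  ≤ᵗ-trans : ∀ x y z → x ≤ᵗ y → y ≤ᵗ z → x ≤ᵗ z
  ≤ᵗ-trans leaf     y z p q = tt
  ≤ᵗ-trans (node f) y z p q n = <-≤ᵗ-trans (f n) y z (p n) q

  <-≤ᵗ-trans : ∀ x y z → x <ᵗ y → y ≤ᵗ z → x <ᵗ z
  <-≤ᵗ-trans x (node g) z (n , p) q = ≤-<ᵗ-trans x (g n) z p (q n)

  ≤-<ᵗ-trans : ∀ x y z → x ≤ᵗ y → y <ᵗ z → x <ᵗ z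
  ≤-<ᵗ-trans x y (node h) p (n , q) = n , ≤ᵗ-trans x y (h n) p q

<ᵗ⇒≤ᵗ : ∀ x y → x <ᵗ y → x ≤ᵗ y
<ᵗ⇒≤ᵗ leaf     y        p         = tt
<ᵗ⇒≤ᵗ (node f) (node g) (n , p) m = n , <ᵗ⇒≤ᵗ (f m) (g n) (p m)

-- A tree of smaller rank need not be a subtree, so the induction on `x` treats all `y ≤ᵗ x` at
-- once: whatever is below `node f` is at most some `f n`.
<ᵗ-wellFounded : WellFounded _<ᵗ_
<ᵗ-wellFounded x = below x x (≤ᵗ-refl x)
  where
  below : ∀ x y → y ≤ᵗ x → Acc _<ᵗ_ y
  below leaf     y y≤x = acc λ {z} z<y → ⊥-elim (<-≤ᵗ-trans z y leaf z<y y≤x)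
  below (node f) y y≤x = acc λ {z} z<y →
    let n , z≤fn = <-≤ᵗ-trans z y (node f) z<y y≤x in below (f n) z z≤fn

subtree : Tree → List ℕ → Tree
subtree x        []      = x
subtree leaf     (n ∷ l) = leaf
subtree (node f) (n ∷ l) = subtree (f n) l

-- Walks through a finite list of vertices.

module _ {S : Set} (R : Rel S 0ℓ) where

  -- Warshall's recursion: walks whose inner vertices lie in the list.

  Reach : List S → Rel S 0ℓ
  Reach []       u v = R u v
  Reach (w ∷ ws) u v = Reach ws u v ⊎ (Reach ws u w × Reach ws w v)

  Reach-step : ∀ ws {u v} → R u v → Reach ws u v
  Reach-step []       r = r
  Reach-step (w ∷ ws) r = inj₁ (Reach-step ws r)

  Reach-sym : Symmetric R → ∀ ws → Symmetric (Reach ws)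
  Reach-sym R-sym []       r              = R-sym r
  Reach-sym R-sym (w ∷ ws) (inj₁ r)       = inj₁ (Reach-sym R-sym ws r)
  Reach-sym R-sym (w ∷ ws) (inj₂ (r , s)) = inj₂ (Reach-sym R-sym ws s , Reach-sym R-sym ws r)

  Reach-trans : ∀ {ws w u v} → w ∈ ws → Reach ws u w → Reach ws w v → Reach ws u v
  -- A walk to or from `w` that already passes through `w` is shortened at that visit.
  Reach-trans (here refl) p q = inj₂ ([ id , proj₁ ]′ p , [ id , proj₂ ]′ q)
  Reach-trans (there w∈) (inj₁ p)        (inj₁ q)        = inj₁ (Reach-trans w∈ p q)
  Reach-trans (there w∈) (inj₁ p)        (inj₂ (q , q′)) = inj₂ (Reach-trans w∈ p q , q′)
  Reach-trans (there w∈) (inj₂ (p , p′)) (inj₁ q)        = inj₂ (p , Reach-trans w∈ p′ q)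
  Reach-trans (there w∈) (inj₂ (p , _))  (inj₂ (_ , q))  = inj₂ (p , q)

  -- `W n` stands for walks of length at most `n`. Admitting one more inner vertex joins at most two
  -- walks, so the bound doubles with each entry of the list.
  Reach⇒ : (W : ℕ → Rel S 0ℓ) →
           (∀ {m n u v} → m ≤ n → W m u v → W n u v) →
           (∀ {u v} → R u v → W 1 u v) →
           (∀ {m n u v w} → W m u w → W n w v → W (m + n) u v) →
           ∀ ws {u v} → Reach ws u v → W (2 ^ length ws) u v
  Reach⇒ W W-mono R⇒W W-trans = go
    where
    go : ∀ ws {u v} → Reach ws u v → W (2 ^ length ws) u v
    go []       r              = R⇒W r
    go (w ∷ ws) (inj₁ r)       = W-mono (m≤m+n _ _) (go ws r)
    go (w ∷ ws) (inj₂ (r , s)) = W-trans (go ws r) (W-mono (m≤m+n _ 0) (go ws s))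

flip : ℕ → Bool → Bool
flip zero    b = b
flip (suc n) b = not (flip n b)

flip-+ : ∀ m n b → flip (m + n) b ≡ flip m (flip n b)
flip-+ zero    n b = refl
flip-+ (suc m) n b = cong not (flip-+ m n b)

flip-double : ∀ n b → flip (n + n) b ≡ b
flip-double zero    b = refl
flip-double (suc n) b = trans (cong not (cong (λ k → flip k b) (+-suc n n)))
  (trans (not-involutive _) (flip-double n b))

drop : ∀ {A : Set} → ℕ → (ℕ → A) → ℕ → A
drop k x i = x (k + i)

infixr 5 _◂_

_◂_ : ∀ {A : Set} → A → (ℕ → A) → ℕ → A
(a ◂ x) zero    = a
(a ◂ x) (suc i) = x i

-- Interlacing patterns of two sequences.

data Side : Set where
  left right : Side

Word : Set
Word = List Side

alternate : ℕ → Word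
alternate zero    = []
alternate (suc n) = left ∷ right ∷ alternate n

-- Room for the indices in `¬drift-closed`: `s + s * p` with `p ≤ s`, and up to `suc s * suc s`
-- beyond it.
span : ℕ → ℕ
span s = suc (s + s * s + suc s * suc s)

-- The first letters shift `x` by `s` terms against `y`. The last ones make up for it: both
-- sequences have then used `s + span s` terms, and the next pattern starts level.
weave : ℕ → Word
weave s = replicate s left ++ alternate (span s) ++ replicate s right

weaves : (ℕ → ℕ) → ℕ → Word
weaves t zero    = []
weaves t (suc n) = weave (t 0) ++ weaves (drop 1 t) n

module Interleaving {O : Set} (_≺_ : Rel O 0ℓ) where

  -- The letters of w pick the next term of x or of y, and the terms
  -- picked form an increasing sequence above γ.

  Merge : O → Word → (ℕ → O) → (ℕ → O) → Set
  Merge γ []          x y = ⊤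
  Merge γ (left ∷ w)  x y = γ ≺ x 0 × Merge (x 0) w (drop 1 x) y
  Merge γ (right ∷ w) x y = γ ≺ y 0 × Merge (y 0) w x (drop 1 y)

  Merge-cong : ∀ {γ} w {x x′ y y′} →
               (∀ i → i < length w → x i ≡ x′ i) → (∀ i → i < length w → y i ≡ y′ i) →
               Merge γ w x y → Merge γ w x′ y′
  Merge-cong []          p q m = tt
  Merge-cong (left ∷ w)  p q (γ≺x , m) rewrite p 0 z<s =
    γ≺x , Merge-cong w (λ i i< → p (suc i) (s<s i<)) (λ i i< → q i (m<n⇒m<1+n i<)) m
  Merge-cong (right ∷ w) p q (γ≺y , m) rewrite q 0 z<s =
    γ≺y , Merge-cong w (λ i i< → p i (m<n⇒m<1+n i<)) (λ i i< → q (suc i) (s<s i<)) m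

  Interlaced : ℕ → (ℕ → O) → (ℕ → O) → Set
  Interlaced n x y = (∀ i → i < n → x i ≺ y i) × (∀ i → suc i < n → y i ≺ x (suc i))

  Merge-left : ∀ s {γ w x y} → Merge γ (replicate s left ++ w) x y →
               ∃ λ γ′ → Merge γ′ w (drop s x) y
  Merge-left zero    {γ} m = γ , m
  Merge-left (suc s) (_ , m) = Merge-left s m

  Merge-right : ∀ s {γ w x y} → Merge γ (replicate s right ++ w) x y →
                ∃ λ γ′ → Merge γ′ w x (drop s y)
  Merge-right zero    {γ} m = γ , m
  Merge-right (suc s) (_ , m) = Merge-right s m

  Merge-alternate : ∀ n {γ w x y} → Merge γ (alternate n ++ w) x y →
                    Interlaced n x y × ∃ λ γ′ → Merge γ′ w (drop n x) (drop n y)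
  Merge-alternate zero    {γ} m = ((λ _ ()) , (λ _ ())) , γ , m
  Merge-alternate (suc n) {γ} {w} {x} {y} (_ , x₀≺y₀ , m) =
    let (p , q) , m′ = Merge-alternate n m in (p′ p , q′ n m q) , m′
    where
    p′ : (∀ i → i < n → x (suc i) ≺ y (suc i)) → ∀ i → i < suc n → x i ≺ y i
    p′ p zero    _  = x₀≺y₀
    p′ p (suc i) i< = p i (s<s⁻¹ i<)
    -- These inequalities are read off the first letter of the following round, which the last round
    -- lacks.
    q′ : ∀ n → Merge (y 0) (alternate n ++ w) (drop 1 x) (drop 1 y) →
         (∀ i → suc i < n → y (suc i) ≺ x (2+ i)) →
         ∀ i → suc i < suc n → y i ≺ x (suc i)
    q′ zero    _           _ zero    (s≤s ())
    q′ (suc n) (y₀≺x₁ , _) q zero    _  = y₀≺x₁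
    q′ n       _           q (suc i) i< = q i (s<s⁻¹ i<)

  Shifted : ℕ → (ℕ → O) → (ℕ → O) → Set
  Shifted s x y = Interlaced (span s) (drop s x) y

  Merge-weave : ∀ s {γ w x y} → Merge γ (weave s ++ w) x y →
                Shifted s x y × ∃ λ γ′ → Merge γ′ w (drop (s + span s) x) (drop (s + span s) y)
  Merge-weave s {γ} {w} {x} {y} m
    with γ₁ , m₁ ← Merge-left s (subst (λ v → Merge γ v x y) (++-assoc (replicate s left) _ w) m)
    with shifted , γ₂ , m₂ ← Merge-alternate (span s)
           (subst (λ v → Merge γ₁ v (drop s x) y) (++-assoc (alternate (span s)) _ w) m₁)
    with γ₃ , m₃ ← Merge-right s m₂
    = shifted , γ₃ , Merge-cong w
        (λ i _ → cong x (sym (+-assoc s (span s) i)))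
        (λ i _ → cong y (trans (sym (+-assoc (span s) s i)) (cong (_+ i) (+-comm (span s) s))))
        m₃

  skip : (ℕ → ℕ) → ℕ → (ℕ → O) → ℕ → O
  skip t zero    x = x
  skip t (suc m) x = skip (drop 1 t) m (drop (t 0 + span (t 0)) x)

  -- The place of the `m`-th pattern does not depend on `n`, so all edges of index at least `m` give
  -- the same relation between the sequences left by `skip t m`.
  Merge-weaves : ∀ t {m n} → m < n → ∀ {γ x y} → Merge γ (weaves t n) x y →
                 Shifted (t m) (skip t m x) (skip t m y)
  Merge-weaves t {zero}  {suc n} _   m = proj₁ (Merge-weave (t 0) m)
  Merge-weaves t {suc k} {suc n} k<n m =
    Merge-weaves (drop 1 t) (s<s⁻¹ k<n) (proj₂ (proj₂ (Merge-weave (t 0) m)))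

  -- Index drift along walks.

  module Walks (≺-trans : Transitive _≺_) (≺-irrefl : ∀ {α} → ¬ α ≺ α) (s : ℕ) where

    -- An edge from x up to y lowers the index by s, an edge down raises
    -- it by s + 1, and the terms increase in both cases.  So Drift p q
    -- holds along walks with p edges up and q edges down.

    Drift : ℕ → ℕ → Rel (ℕ → O) 0ℓ
    Drift p q u v = ∀ i j → s * p ≤ i → i + suc s * q < span s →
                    i + suc s * q ≡ j + s * p → u i ≺ v j

    drift-up : ∀ {x y} → Shifted s x y → Drift 1 0 x y
    drift-up {x} {y} (x≺y , _) i j _ i< eq = subst (λ k → x k ≺ y j) (sym i≡s+j) (x≺y j j<)
      where
      i≡s+j : i ≡ s + j
      i≡s+j = trans (sym (+-identityʳ i)) (trans (cong (i +_) (sym (*-zeroʳ s)))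
        (trans eq (trans (cong (j +_) (*-identityʳ s)) (+-comm j s))))
      j< : j < span s
      j< = ≤-<-trans (≤-trans (m≤n+m j s) (≤-trans (≤-reflexive (sym i≡s+j)) (m≤m+n i _))) i<

    drift-down : ∀ {x y} → Shifted s x y → Drift 0 1 y x
    drift-down {x} {y} (_ , y≺x) i j _ i< eq = subst (λ k → y i ≺ x k) s+1+i≡j (y≺x i 1+i<)
      where
      s+1+i≡j : s + suc i ≡ j
      s+1+i≡j = trans
        (trans (+-comm s (suc i)) (trans (sym (+-suc i s)) (cong (i +_) (sym (*-identityʳ (suc s))))))
        (trans eq (trans (cong (j +_) (*-zeroʳ s)) (+-identityʳ j)))
      1+i< : suc i < span s
      1+i< = ≤-<-trans (≤-trans (≤-reflexive (+-comm 1 i)) (+-monoʳ-≤ i (s≤s z≤n))) i<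

    -- The lower bound on `i` leaves room for all upward edges to come first, the upper bound for
    -- all downward ones; so the intermediate index `k` is in range whatever the order.
    drift-trans : ∀ {p q p′ q′ u v w} → Drift p q u w → Drift p′ q′ w v → Drift (p + p′) (q + q′) u v
    drift-trans {p} {q} {p′} {q′} d d′ i j sp≤i i< eq = ≺-trans
      (d i k (≤-trans (m≤m+n (s * p) (s * p′)) sp+sp′≤i)
         (≤-<-trans (+-monoʳ-≤ i (*-monoʳ-≤ (suc s) (m≤m+n q q′))) i<) (sym k+sp≡))
      (d′ k j sp′≤k (≤-<-trans k+≤ i<) k+≡)
      where
      k = i + suc s * q ∸ s * p
      sp+sp′≤i : s * p + s * p′ ≤ i
      sp+sp′≤i = subst (_≤ i) (*-distribˡ-+ s p p′) sp≤i
      k+sp≡ : k + s * p ≡ i + suc s * q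
      k+sp≡ = m∸n+n≡m (≤-trans (m≤m+n (s * p) (s * p′)) (≤-trans sp+sp′≤i (m≤m+n i _)))
      sp′≤k : s * p′ ≤ k
      sp′≤k = m+n≤o⇒m≤o∸n (s * p′)
        (≤-trans (≤-reflexive (+-comm (s * p′) (s * p))) (≤-trans sp+sp′≤i (m≤m+n i _)))
      total : k + suc s * q′ + s * p ≡ i + suc s * (q + q′)
      total = trans (solve 3 (λ a b c → a :+ b :+ c := (a :+ c) :+ b) refl k (suc s * q′) (s * p))
        (trans (cong (_+ suc s * q′) k+sp≡)
          (solve 4 (λ a b c d → a :+ b :* c :+ b :* d := a :+ b :* (c :+ d)) refl i (suc s) q q′))
        where open +-*-Solver
      k+≤ : k + suc s * q′ ≤ i + suc s * (q + q′)
      k+≤ = ≤-trans (m≤m+n _ (s * p)) (≤-reflexive total)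
      k+≡ : k + suc s * q′ ≡ j + s * p′
      k+≡ = +-cancelʳ-≡ (s * p) _ _ (trans total (trans eq
        (solve 4 (λ j s p p′ → j :+ s :* (p :+ p′) := j :+ s :* p′ :+ s :* p) refl j s p p′)))
        where open +-*-Solver

    Adjacent : Rel (ℕ → O) 0ℓ
    Adjacent u v = Shifted s u v ⊎ Shifted s v u

    -- Following an edge and returning raises the index by one in total, so a sequence with a
    -- neighbour has a long increasing stretch.
    drift-increasing : ∀ {u v} → Adjacent u v → Drift 1 1 u u
    drift-increasing {u} {v} (inj₁ e) =
      drift-trans {1} {0} {0} {1} {w = v} (drift-up {u} {v} e) (drift-down {u} {v} e)
    drift-increasing {u} {v} (inj₂ e) =
      drift-trans {0} {1} {1} {0} {w = v} (drift-down {v} {u} e) (drift-up {v} {u} e)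

    increasing : ∀ {u} → Drift 1 1 u u → ∀ {i j} → s ≤ j → j ≤′ i → i + suc s < span s →
                 j ≡ i ⊎ u j ≺ u i
    increasing d s≤j ≤′-refl i< = inj₁ refl
    increasing {u} d {suc i} {j} s≤j (≤′-step j≤i) i< =
      inj₂ ([ (λ j≡i → subst (λ k → u k ≺ u (suc i)) (sym j≡i) uᵢ≺) , (λ uⱼ≺ → ≺-trans uⱼ≺ uᵢ≺) ]′
        (increasing d s≤j j≤i (<-trans (n<1+n _) i<)))
      where
      open +-*-Solver
      uᵢ≺ : u i ≺ u (suc i)
      uᵢ≺ = d i (suc i)
        (≤-trans (≤-reflexive (*-identityʳ s)) (≤-trans s≤j (≤′⇒≤ j≤i)))
        (subst (λ k → i + k < span s) (sym (*-identityʳ (suc s))) (<-trans (n<1+n _) i<))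
        (solve 2 (λ i s → i :+ (con 1 :+ s) :* con 1 := con 1 :+ i :+ s :* con 1) refl i s)

    -- From `q < p ≤ s` follows `suc s * q ≤ s * suc q ≤ s * p`: around the closed walk the index
    -- has not risen but the term has, against `increasing`.
    ¬drift-closed : ∀ {p q u} → q < p → p ≤ s → Drift 1 1 u u → ¬ Drift p q u u
    ¬drift-closed {p} {q} {u} q<p p≤s inc d =
      [ (λ j≡i → ≺-irrefl (subst (λ k → u i ≺ u k) j≡i uᵢ≺uⱼ))
      , (λ uⱼ≺uᵢ → ≺-irrefl (≺-trans uᵢ≺uⱼ uⱼ≺uᵢ)) ]′
      (increasing inc (m≤m+n s _) (≤⇒≤′ j≤i) (bound (m≤m*n (suc s) (suc s))))
      where
      open +-*-Solver using (solve; _:+_; _:*_; _:=_; con)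
      i j : ℕ
      -- The summand `s` brings `j` into the range of `increasing`.
      i = s + s * p
      j = s + suc s * q
      q≤s : q ≤ s
      q≤s = ≤-trans (<⇒≤ q<p) p≤s
      bound : ∀ {r} → r ≤ suc s * suc s → i + r < span s
      bound r≤ = s≤s (+-mono-≤ (+-monoʳ-≤ s (*-monoʳ-≤ s p≤s)) r≤)
      j≤i : j ≤ i
      j≤i = +-monoʳ-≤ s (≤-trans (+-monoˡ-≤ (s * q) q≤s)
        (≤-trans (≤-reflexive (sym (*-suc s q))) (*-monoʳ-≤ s q<p)))
      uᵢ≺uⱼ : u i ≺ u j
      uᵢ≺uⱼ = d i j (m≤n+m _ s) (bound (*-monoʳ-≤ (suc s) (m≤n⇒m≤1+n q≤s)))
        (solve 3 (λ s p q → s :+ s :* p :+ (con 1 :+ s) :* q := s :+ (con 1 :+ s) :* q :+ s :* p)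
          refl s p q)

-- Carries patterns of natural numbers over to countable ordinals, for the finite subgraphs of large
-- chromatic number.
Merge-map : {A B : Set} {_<ᴬ_ : Rel A 0ℓ} {_<ᴮ_ : Rel B 0ℓ} (ι : A → B) →
            (∀ {a b} → a <ᴬ b → ι a <ᴮ ι b) → ∀ {γ} w {x y} →
            Interleaving.Merge _<ᴬ_ γ w x y → Interleaving.Merge _<ᴮ_ (ι γ) w (ι ∘ x) (ι ∘ y)
Merge-map ι ι-mono []          m           = tt
Merge-map ι ι-mono (left ∷ w)  (γ<x₀ , m) = ι-mono γ<x₀ , Merge-map ι ι-mono w m
Merge-map ι ι-mono (right ∷ w) (γ<y₀ , m) = ι-mono γ<y₀ , Merge-map ι ι-mono w m

-- Null is the σ-ideal of sets that are small by repeatedly bounding the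
-- next term.

data Null {O : Set} (_≺_ : Rel O 0ℓ) : ((ℕ → O) → Set) → Set₁ where
  empty   : ∀ {A} → (∀ x → ¬ A x) → Null _≺_ A
  bounded : ∀ {A} γ → (∀ α → γ ≺ α → Null _≺_ (λ x → A (α ◂ x))) → Null _≺_ A

-- The bipartite double cover: closed walks of odd length at `v` become walks from `(v , true)` to
-- `(v , false)`.
double : {V : Set} → Rel V 0ℓ → Rel (V × Bool) 0ℓ
double E (u , b) (v , b′) = E u v × b′ ≡ not b

double-sym : {V : Set} {E : Rel V 0ℓ} → Symmetric E → Symmetric (double E)
double-sym E-sym (e , refl) = E-sym e , sym (not-involutive _)

states : {V : Set} → List V → List (V × Bool)
states vs = map (_, true) vs ++ map (_, false) vs

∈-states : {V : Set} {v : V} {vs : List V} → v ∈ vs → ∀ b → (v , b) ∈ states vs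
∈-states v∈ true  = ∈-++⁺ˡ (∈-map⁺ _ v∈)
∈-states v∈ false = ∈-++⁺ʳ _ (∈-map⁺ _ v∈)

length-states : {V : Set} (vs : List V) → length (states vs) ≡ length vs + length vs
length-states vs = trans (length-++ (map (_, true) vs))
  (cong₂ _+_ (length-map (_, true) vs) (length-map (_, false) vs))

-- Supplies the neighbour that `drift-increasing` asks for.
Reach-head : {S : Set} {R : Rel S 0ℓ} → ∀ ws {u v} → Reach R ws u v → ∃ λ w → R u w
Reach-head []       {v = v} r      = v , r
Reach-head (w ∷ ws) (inj₁ r)       = Reach-head ws r
Reach-head (w ∷ ws) (inj₂ (r , _)) = Reach-head ws r

-- Odd closed walks.

module OddWalks
  {O : Set} {_≺_ : Rel O 0ℓ} (≺-trans : Transitive _≺_) (≺-irrefl : ∀ {α} → ¬ α ≺ α) (s : ℕ)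
  where
  open Interleaving _≺_
  open Walks ≺-trans ≺-irrefl s public

  -- Both directions are kept because `¬drift-closed` needs more upward than downward edges, which
  -- may hold only for the reversed walk.
  record Walk (n : ℕ) (σ τ : (ℕ → O) × Bool) : Set where
    field
      up down  : ℕ
      length≤  : up + down ≤ n
      parity   : flip (up + down) (proj₂ σ) ≡ proj₂ τ
      forward  : Drift up down (proj₁ σ) (proj₁ τ)
      backward : Drift down up (proj₁ τ) (proj₁ σ)
  open Walk

  walk-mono : ∀ {m n σ τ} → m ≤ n → Walk m σ τ → Walk n σ τ
  walk-mono m≤n W = record
    { up = up W ; down = down W ; length≤ = ≤-trans (length≤ W) m≤n
    ; parity = parity W ; forward = forward W ; backward = backward W }

  walk-edge : ∀ {σ τ} → double Adjacent σ τ → Walk 1 σ τ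
  walk-edge {u , _} {v , _} (inj₁ e , refl) = record
    { up = 1 ; down = 0 ; length≤ = ≤-refl ; parity = refl
    ; forward = drift-up {u} {v} e ; backward = drift-down {u} {v} e }
  walk-edge {u , _} {v , _} (inj₂ e , refl) = record
    { up = 0 ; down = 1 ; length≤ = ≤-refl ; parity = refl
    ; forward = drift-down {v} {u} e ; backward = drift-up {v} {u} e }

  walk-trans : ∀ {m n σ τ ρ} → Walk m σ ρ → Walk n ρ τ → Walk (m + n) σ τ
  walk-trans {m} {n} {σ} {τ} {ρ} W W′ = record
    { up = up W + up W′ ; down = down W + down W′
    ; length≤ = ≤-trans (≤-reflexive (solve 4 (λ a b c d → a :+ b :+ (c :+ d) := a :+ c :+ (b :+ d))
        refl (up W) (up W′) (down W) (down W′))) (+-mono-≤ (length≤ W) (length≤ W′))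
    ; parity = trans (cong (λ k → flip k (proj₂ σ))
        (solve 4 (λ a b c d → a :+ b :+ (c :+ d) := b :+ d :+ (a :+ c))
          refl (up W) (up W′) (down W) (down W′)))
        (trans (flip-+ (up W′ + down W′) (up W + down W) (proj₂ σ))
          (trans (cong (flip (up W′ + down W′)) (parity W)) (parity W′)))
    ; forward = drift-trans {up W} {down W} {w = proj₁ ρ} (forward W) (forward W′)
    ; backward = subst₂ (λ a b → Drift a b (proj₁ τ) (proj₁ σ))
        (+-comm (down W′) (down W)) (+-comm (up W′) (up W))
        (drift-trans {down W′} {up W′} {w = proj₁ ρ} (backward W′) (backward W)) }
    where open +-*-Solver

  -- Odd length forces `up` and `down` to differ, so the walk or its reverse contradicts
  -- `¬drift-closed`.
  ¬odd-closed-walk : ∀ {n u} → n ≤ s → Drift 1 1 u u → ¬ Walk n (u , true) (u , false)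
  ¬odd-closed-walk {n} {u} n≤s inc W with <-cmp (up W) (down W)
  ... | tri< p<q _ _ = ¬drift-closed {u = u} p<q
    (≤-trans (≤-trans (m≤n+m _ _) (length≤ W)) n≤s) inc (backward W)
  ... | tri> _ _ q<p = ¬drift-closed {u = u} q<p
    (≤-trans (≤-trans (m≤m+n _ _) (length≤ W)) n≤s) inc (forward W)
  ... | tri≈ _ p≡q _ with () ← trans (sym (flip-double (up W) true))
                                (subst (λ q → flip (up W + q) true ≡ false) (sym p≡q) (parity W))

-- Finite colour sets and numerical bounds.

recolour : ∀ {H A B} → A ↣ B → Colouring H A → Colouring H B
recolour i (c , proper) = Injection.to i ∘ c , λ u~v eq → proper u~v (Injection.injective i eq)

Fin↣Fin : ∀ {m n} → m ≤ n → Fin m ↣ Fin n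
Fin↣Fin m≤n = mk↣ {to = λ i → inject≤ i m≤n} (inject≤-injective m≤n m≤n _ _)

Fin↣Fin⇒≤ : ∀ {m n} → Fin m ↣ Fin n → m ≤ n
Fin↣Fin⇒≤ i = injective⇒≤ (Injection.injective i)

bounded-Fin : ∀ {n} (f : Fin n → ℕ) → ∃ λ N → ∀ i → f i < N
bounded-Fin {zero}  f = 0 , λ ()
bounded-Fin {suc n} f = let N , f< = bounded-Fin (f ∘ suc) in
  suc (f zero) + N , λ { zero → m≤m+n _ N ; (suc i) → ≤-trans (f< i) (m≤n+m N _) }

sumUpTo : (ℕ → ℕ) → ℕ → ℕ
sumUpTo f zero    = f 0
sumUpTo f (suc n) = f (suc n) + sumUpTo f n

≤-sumUpTo : ∀ f {k n} → k ≤′ n → f k ≤ sumUpTo f n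
≤-sumUpTo f {n = zero}  ≤′-refl       = ≤-refl
≤-sumUpTo f {n = suc n} ≤′-refl       = m≤m+n _ _
≤-sumUpTo f             (≤′-step k≤n) = ≤-trans (≤-sumUpTo f k≤n) (m≤n+m _ _)

-- The lower bound makes `2 ^ m * 2` colours fewer than `k`; the upper one leaves finitely many `k`
-- for each `m`, so that one shift can serve them all.
dyadic : ∀ k → 3 ≤ k → ∃ λ m → 2 ^ suc m < k × k ≤ 2 ^ suc (suc m)
dyadic (suc zero)             (s≤s ())
dyadic (suc (suc zero))       (s≤s (s≤s ()))
dyadic (suc (suc (suc zero))) _ = 0 , ≤-refl , n≤1+n 3
dyadic (suc k@(suc (suc (suc _)))) _ with dyadic k (s≤s (s≤s (s≤s z≤n)))
... | m , lo , hi with m≤n⇒m<n∨m≡n hi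
...   | inj₁ k< = m , m<n⇒m<1+n lo , k<
...   | inj₂ k≡ = suc m , s≤s (≤-reflexive (sym k≡)) ,
  ≤-trans (s≤s hi) (^-monoʳ-< 2 ≤-refl (n<1+n (suc (suc m))))

nth : List ℕ → ℕ → ℕ
nth []      i       = 0
nth (a ∷ l) zero    = a
nth (a ∷ l) (suc i) = nth l i

prefix : ℕ → (ℕ → ℕ) → List ℕ
prefix zero    x = []
prefix (suc n) x = x 0 ∷ prefix n (drop 1 x)

nth-prefix : ∀ {n} x {i} → i < n → nth (prefix n x) i ≡ x i
nth-prefix {suc n} x {zero}  _  = refl
nth-prefix {suc n} x {suc i} i< = nth-prefix (drop 1 x) (s<s⁻¹ i<)

-- Choice from excluded middle and extensionality.

module Classical (em : ∀ ℓ → ExcludedMiddle ℓ) (ext : ∀ a b → Extensionality a b) where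

  by-contradiction : ∀ {ℓ} {P : Set ℓ} → ¬ ¬ P → P
  by-contradiction = decidable-stable (em _)

  ¬∀⇒∃¬ : ∀ {a p} {A : Set a} {P : A → Set p} → ¬ (∀ x → P x) → ∃ λ x → ¬ P x
  ¬∀⇒∃¬ ¬∀ = by-contradiction λ ¬∃ → ¬∀ λ x → by-contradiction λ ¬Px → ¬∃ (x , ¬Px)

  ⟦_⟧ : Set → Bool
  ⟦ P ⟧ = does (em 0ℓ {P})

  ⟦⟧-intro : {P : Set} → P → ⟦ P ⟧ ≡ true
  ⟦⟧-intro = dec-true (em 0ℓ)

  ⟦⟧-elim : {P : Set} → ⟦ P ⟧ ≡ true → P
  ⟦⟧-elim = dec-true⁻¹ (em 0ℓ)

  ⟦⟧-cong : {P Q : Set} → (P → Q) → (Q → P) → ⟦ P ⟧ ≡ ⟦ Q ⟧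
  ⟦⟧-cong f g = does-⇔ (mk⇔ f g) (em 0ℓ) (em 0ℓ)

  pick : {A : Set} → A → 2^ A → A
  pick {A} a S with em 0ℓ {∃ λ x → S x ≡ true}
  ... | yes (x , _) = x
  ... | no _        = a

  pick-∈ : {A : Set} (a : A) (S : 2^ A) {x : A} → S x ≡ true → S (pick a S) ≡ true
  pick-∈ a S {x} Sx with em 0ℓ {∃ λ x → S x ≡ true}
  ... | yes (_ , p) = p
  ... | no ¬p       = ⊥-elim (¬p (x , Sx))

  choose : {A : Set} → A → (A → Set) → A
  choose a P = pick a (λ x → ⟦ P x ⟧)

  choose-∈ : {A : Set} (a : A) (P : A → Set) {x : A} → P x → P (choose a P)
  choose-∈ a P Px = ⟦⟧-elim (pick-∈ a (λ x → ⟦ P x ⟧) (⟦⟧-intro Px))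

  -- Equivalent predicates have the same truth values, hence are one and the same argument of
  -- `pick`. So `choose` yields canonical representatives.
  choose-cong : {A : Set} (a : A) {P Q : A → Set} →
                (∀ x → P x → Q x) → (∀ x → Q x → P x) → choose a P ≡ choose a Q
  choose-cong a P⊆Q Q⊆P = cong (pick a) (ext _ _ λ x → ⟦⟧-cong (P⊆Q x) (Q⊆P x))

  least : ∀ {ℓ} (P : ℕ → Set ℓ) → ∃ P → ∃ λ n → P n × (∀ m → P m → n ≤ m)
  least P (n , Pn) = All.wfRec <-wellFounded _ (λ n → P n → Least) step n Pn
    where
    Least = ∃ λ n → P n × (∀ m → P m → n ≤ m)
    step : ∀ n → (∀ {m} → m < n → P m → Least) → P n → Least
    step n IH Pn with em _ {∃ λ m → m < n × P m}
    ... | yes (m , m<n , Pm) = IH m<n Pm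
    ... | no ¬∃ = n , Pn , λ m Pm → ≮⇒≥ λ m<n → ¬∃ (m , m<n , Pm)

  -- Well-orders with countable initial segments.

  module Embedding
    {A : Set} {_≺_ : Rel A 0ℓ} (wf : WellFounded _≺_)
    (connex : ∀ {x y} → x ≢ y → x ≺ y ⊎ y ≺ x)
    (countable : ∀ x → Σ[ c ∈ (A → ℕ) ] (∀ {y z} → y ≺ x → z ≺ x → c y ≡ c z → y ≡ z))
    {B : Set} (uncountable : ¬ (B ↣ ℕ))
    where

    private
      b₀ : B
      b₀ = by-contradiction λ ¬B →
        uncountable (mk↣ {to = λ b → ⊥-elim (¬B b)} λ {b} → ⊥-elim (¬B b))

      Fresh : ∀ x → (∀ {y} → y ≺ x → B) → Set
      Fresh x F = ∃ λ b → ∀ {y} (y≺x : y ≺ x) → F y≺x ≢ b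

      step : ∀ x → (∀ {y} → y ≺ x → B) → B
      step x F with em 0ℓ {Fresh x F}
      ... | yes (b , _) = b
      ... | no _        = b₀

      step-fresh : ∀ x (F : ∀ {y} → y ≺ x → B) → Fresh x F →
                   ∀ {y} (y≺x : y ≺ x) → F y≺x ≢ step x F
      step-fresh x F fresh with em 0ℓ {Fresh x F}
      ... | yes (_ , p) = p
      ... | no ¬fresh   = ⊥-elim (¬fresh fresh)

      step-cong : ∀ x {F G : ∀ {y} → y ≺ x → B} →
                  (∀ {y} (y≺x : y ≺ x) → F y≺x ≡ G y≺x) → step x F ≡ step x G
      step-cong x F≗G = cong (λ (F : ∀ {y} → y ≺ x → B) → step x F)
        (implicit-extensionality (ext _ _) λ {y} → ext _ _ F≗G)

      f : A → B
      f = All.wfRec wf _ (λ _ → B) step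

      -- If every `b` were a value below `x`, the numbering of that segment would number `B`.
      fresh : ∀ x → Fresh x (λ {y} _ → f y)
      fresh x = by-contradiction λ ¬fresh →
        let preimage : ∀ b → ∃ λ y → y ≺ x × f y ≡ b
            preimage b = by-contradiction λ ¬pre →
              ¬fresh (b , λ {y} y≺x fy≡b → ¬pre (y , y≺x , fy≡b))
            c , c-injective = countable x
        in uncountable $ mk↣ {to = λ b → c (proj₁ (preimage b))} λ {b} {b′} eq →
             let y , y≺x , fy≡b = preimage b
                 z , z≺x , fz≡b′ = preimage b′
             in trans (sym fy≡b) (trans (cong f (c-injective y≺x z≺x eq)) fz≡b′)

      f-≢ : ∀ {x y} → y ≺ x → f y ≢ f x
      f-≢ {x} y≺x fy≡fx = step-fresh x (λ {y} _ → f y) (fresh x) y≺x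
        (trans fy≡fx (FixPoint.unfold-wfRec wf (λ _ → B) step step-cong))

    embedding : A ↣ B
    embedding = mk↣ {to = f} λ {x} {y} fx≡fy → by-contradiction λ x≢y →
      [ (λ x≺y → f-≢ x≺y fx≡fy) , (λ y≺x → f-≢ y≺x (sym fx≡fy)) ]′ (connex x≢y)

  -- The countable ordinals and ℵ₁.

  mutual
    ≤ᵗ-<ᵗ-total : ∀ x y → x ≤ᵗ y ⊎ y <ᵗ x
    ≤ᵗ-<ᵗ-total leaf     y = inj₁ tt
    ≤ᵗ-<ᵗ-total (node f) y with em 0ℓ {∀ n → f n <ᵗ y}
    ... | yes p = inj₁ p
    ... | no ¬p with n , ¬fn<y ← ¬∀⇒∃¬ ¬p with <ᵗ-≤ᵗ-total (f n) y
    ...   | inj₁ fn<y = ⊥-elim (¬fn<y fn<y)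
    ...   | inj₂ y≤fn = inj₂ (n , y≤fn)

    <ᵗ-≤ᵗ-total : ∀ x y → x <ᵗ y ⊎ y ≤ᵗ x
    <ᵗ-≤ᵗ-total x leaf     = inj₂ tt
    <ᵗ-≤ᵗ-total x (node g) with em 0ℓ {∃ λ n → x ≤ᵗ g n}
    ... | yes p = inj₁ p
    ... | no ¬p = inj₂ λ n →
      [ (λ x≤gn → ⊥-elim (¬p (n , x≤gn))) , id ]′ (≤ᵗ-<ᵗ-total x (g n))

  -- While the rank exceeds that of `y`, some branch still has rank at least that of `y`. Addresses
  -- are lists of numbers, so only countably many ranks lie up to a given one.
  ≤ᵗ⇒≈subtree : ∀ x y → y ≤ᵗ x → ∃ λ l → subtree x l ≈ᵗ y
  ≤ᵗ⇒≈subtree x y y≤x with ≤ᵗ-<ᵗ-total x y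
  ... | inj₁ x≤y = [] , x≤y , y≤x
  ≤ᵗ⇒≈subtree leaf     y y≤x | inj₂ ()
  ≤ᵗ⇒≈subtree (node f) y y≤x | inj₂ (n , y≤fn) =
    let l , p = ≤ᵗ⇒≈subtree (f n) y y≤fn in n ∷ l , p

  ≈ᵗ-sym : ∀ {x y} → x ≈ᵗ y → y ≈ᵗ x
  ≈ᵗ-sym (p , q) = q , p

  ≈ᵗ-trans : ∀ {x y z} → x ≈ᵗ y → y ≈ᵗ z → x ≈ᵗ z
  ≈ᵗ-trans {x} {y} {z} (p , q) (r , s) = ≤ᵗ-trans x y z p r , ≤ᵗ-trans z y x s q

  rep : Tree → Tree
  rep x = choose leaf (_≈ᵗ x)

  rep-≈ : ∀ x → rep x ≈ᵗ x
  rep-≈ x = choose-∈ leaf (_≈ᵗ x) {x} (≤ᵗ-refl x , ≤ᵗ-refl x)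

  rep-cong : ∀ {x y} → x ≈ᵗ y → rep x ≡ rep y
  rep-cong {x} {y} x≈y = choose-cong leaf
    (λ z z≈x → ≈ᵗ-trans {z} {x} {y} z≈x x≈y)
    (λ z z≈y → ≈ᵗ-trans {z} {y} {x} z≈y (≈ᵗ-sym {x} {y} x≈y))

  -- The ordinal ω₁: trees modulo equal rank, with the quotient taken as the set of canonical
  -- representatives.
  Ω : Set
  Ω = ∃ λ x → rep x ≡ x

  ⟨_⟩ : Tree → Ω
  ⟨ x ⟩ = rep x , rep-cong (rep-≈ x)

  infix 4 _<Ω_

  _<Ω_ : Rel Ω 0ℓ
  _<Ω_ = _<ᵗ_ on proj₁

  ≈ᵗ⇒≡ : {α β : Ω} → proj₁ α ≈ᵗ proj₁ β → α ≡ β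
  ≈ᵗ⇒≡ {x , p} {y , q} x≈y with refl ← trans (sym p) (trans (rep-cong x≈y) q) =
    cong (x ,_) (≡-irrelevant p q)

  <Ω-trans : ∀ {α β γ} → α <Ω β → β <Ω γ → α <Ω γ
  <Ω-trans {x , _} {y , _} {z , _} x<y y<z = <-≤ᵗ-trans x y z x<y (<ᵗ⇒≤ᵗ y z y<z)

  <Ω-wellFounded : WellFounded _<Ω_
  <Ω-wellFounded = On.wellFounded proj₁ <ᵗ-wellFounded

  <Ω-irrefl : ∀ {α} → ¬ α <Ω α
  <Ω-irrefl {α} α<α = wf⇒asym <Ω-wellFounded {α} {α} α<α α<α

  <Ω-connex : ∀ {α β} → α ≢ β → α <Ω β ⊎ β <Ω α
  <Ω-connex {x , p} {y , q} α≢β with ≤ᵗ-<ᵗ-total x y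
  ... | inj₂ y<x = inj₂ y<x
  ... | inj₁ x≤y with ≤ᵗ-<ᵗ-total y x
  ...   | inj₂ x<y = inj₁ x<y
  ...   | inj₁ y≤x = ⊥-elim (α≢β (≈ᵗ⇒≡ (x≤y , y≤x)))

  <Ω-bound : (s : ℕ → Ω) → ∃ λ β → ∀ n → s n <Ω β
  <Ω-bound s = ⟨ node (proj₁ ∘ s) ⟩ , λ n →
    <-≤ᵗ-trans (proj₁ (s n)) (node (proj₁ ∘ s)) (rep (node (proj₁ ∘ s)))
      (n , ≤ᵗ-refl _) (proj₂ (rep-≈ (node (proj₁ ∘ s))))

  -- An injection would list all of `Ω` as a sequence, which would contain its own strict upper
  -- bound.
  Ω-uncountable : (f : Ω → ℕ) → ¬ Injective _≡_ _≡_ f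
  Ω-uncountable f f-injective =
    <Ω-irrefl {proj₁ β} (subst (_<Ω proj₁ β) s-f (proj₂ β (f (proj₁ β))))
    where
    s : ℕ → Ω
    s n = choose ⟨ leaf ⟩ λ α → f α ≡ n
    s-f : ∀ {α} → s (f α) ≡ α
    s-f {α} = f-injective (choose-∈ ⟨ leaf ⟩ (λ β → f β ≡ f α) {α} refl)
    β = <Ω-bound s

  ≤Ω-countable : (α : Ω) → Σ[ c ∈ (Ω → ℕ) ] (∀ {β γ} →
    proj₁ β ≤ᵗ proj₁ α → proj₁ γ ≤ᵗ proj₁ α → c β ≡ c γ → β ≡ γ)
  ≤Ω-countable (x , _) = (λ β → encode (path β)) , λ {β} {γ} β≤x γ≤x eq →
    ≈ᵗ⇒≡ (≈ᵗ-trans (≈ᵗ-sym (path-≈ β β≤x))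
      (subst (λ l → subtree x l ≈ᵗ proj₁ γ) (sym (encode-injective eq)) (path-≈ γ γ≤x)))
    where
    Path : Ω → List ℕ → Set
    Path β l = subtree x l ≈ᵗ proj₁ β
    path : Ω → List ℕ
    path β = choose [] (Path β)
    path-≈ : ∀ β → proj₁ β ≤ᵗ x → Path β (path β)
    path-≈ β β≤x = let l , p = ≤ᵗ⇒≈subtree x (proj₁ β) β≤x in choose-∈ [] (Path β) {l} p

  -- The factor ℕ makes the sequences in Ω a quotient of 2^ ℵ₁, see decode.

  ℵ₁ : Set
  ℵ₁ = Ω × ℕ

  -- In the lexicographic order, what precedes `(α , n)` has first component at most `α`, which
  -- leaves countably many pairs.
  ℵ₁-embeds : {B : Set} → ¬ (B ↣ ℕ) → ℵ₁ ↣ B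
  ℵ₁-embeds = Embedding.embedding (×-wellFounded <Ω-wellFounded <-wellFounded) connex countable
    where
    _≺_ = ×-Lex _≡_ _<Ω_ _<_
    connex : ∀ {x y} → x ≢ y → x ≺ y ⊎ y ≺ x
    connex {α , m} {β , n} x≢y with em 0ℓ {α ≡ β}
    ... | no α≢β = [ inj₁ ∘ inj₁ , inj₂ ∘ inj₁ ]′ (<Ω-connex α≢β)
    ... | yes refl with <-cmp m n
    ...   | tri< m<n _ _ = inj₁ (inj₂ (refl , m<n))
    ...   | tri≈ _ refl _ = ⊥-elim (x≢y refl)
    ...   | tri> _ _ n<m = inj₂ (inj₂ (refl , n<m))
    ≺⇒≤ : ∀ {x y} → x ≺ y → proj₁ (proj₁ x) ≤ᵗ proj₁ (proj₁ y)
    ≺⇒≤ (inj₁ α<β) = <ᵗ⇒≤ᵗ _ _ α<β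
    ≺⇒≤ (inj₂ (refl , _)) = ≤ᵗ-refl _
    countable : ∀ x → Σ[ c ∈ (ℵ₁ → ℕ) ] (∀ {y z} → y ≺ x → z ≺ x → c y ≡ c z → y ≡ z)
    countable (α , _) = let c , c-injective = ≤Ω-countable α in
      (λ (β , n) → pair (c β) n) , λ {(β , m)} {(γ , n)} y≺x z≺x eq →
        let cβ≡cγ , m≡n = pair-injective {c β} {m} {c γ} {n} eq in
        cong₂ _,_ (c-injective (≺⇒≤ {β , m} y≺x) (≺⇒≤ {γ , n} z≺x) cβ≡cγ) m≡n

  ℵ₁-isAleph₁ : IsAleph₁ ℵ₁
  ℵ₁-isAleph₁ = (mk↣ {to = ⟨ leaf ⟩ ,_} (cong proj₂) , ℵ₁-uncountable) ,
    λ B ℕ<B → ℵ₁-embeds (proj₂ ℕ<B)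
    where
    ℵ₁-uncountable : ¬ (ℵ₁ ↣ ℕ)
    ℵ₁-uncountable i = Ω-uncountable (λ α → Injection.to i (α , 0))
      (λ eq → cong proj₁ (Injection.injective i eq))

  -- Two-colouring finite graphs without odd closed walks.

  module _ {V : Set} {E : Rel V 0ℓ} (E-sym : Symmetric E) {vs : List V} (v∈vs : ∀ v → v ∈ vs) where

    private
      T : Rel (V × Bool) 0ℓ
      T = Reach (double E) (states vs)

      T-trans : ∀ {σ ρ τ} → T σ ρ → T ρ τ → T σ τ
      T-trans {ρ = v , b} = Reach-trans (double E) (∈-states (v∈vs v) b)

      T-sym : Symmetric T
      T-sym = Reach-sym (double E) (double-sym {E = E} E-sym) (states vs)

      T-edge : ∀ {u v} → E u v → ∀ b → T (u , b) (v , not b)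
      T-edge e b = Reach-step (double E) (states vs) (e , refl)

      Meets : V → V × Bool → Set
      Meets v σ = T σ (v , true) ⊎ T σ (v , false)

      Meets-edge : ∀ {u v} → E u v → ∀ σ → Meets u σ → Meets v σ
      Meets-edge e σ (inj₁ r) = inj₂ (T-trans r (T-edge e true))
      Meets-edge e σ (inj₂ r) = inj₁ (T-trans r (T-edge e false))

    -- `Meets` is the same at both ends of an edge, so `root` is constant on components. If the root
    -- reaches `(u , true)` and `(v , true)` for an edge, an odd walk closes at `u`; if neither, it
    -- reaches `(u , false)` and hence `(v , true)` after all.
    two-colouring : (∀ v → ¬ T (v , true) (v , false)) →
                    Σ[ c ∈ (V → Bool) ] (∀ {u v} → E u v → c u ≢ c v)
    two-colouring odd-free with em 0ℓ {V}
    ... | no ¬v  = (λ _ → true) , λ {u} _ → ⊥-elim (¬v u)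
    ... | yes v₀ = (λ v → ⟦ T (root v) (v , true) ⟧) , proper
      where
      root : V → V × Bool
      root v = choose (v₀ , true) (Meets v)

      proper : ∀ {u v} → E u v → ⟦ T (root u) (u , true) ⟧ ≢ ⟦ T (root v) (v , true) ⟧
      proper {u} {v} e eq with em 0ℓ {T (root u) (u , true)}
      ... | yes r = odd-free u (T-trans (T-sym r) (T-trans r′ (T-edge (E-sym e) true)))
        where
        r′ : T (root u) (v , true)
        r′ = subst (λ ρ → T ρ (v , true))
          (choose-cong (v₀ , true) (Meets-edge (E-sym e)) (Meets-edge e))
          (⟦⟧-elim (sym eq))
      ... | no ¬r = v≁ (T-trans u≁ (T-edge e false))
        where
        root≡ : root u ≡ root v
        root≡ = choose-cong (v₀ , true) (Meets-edge e) (Meets-edge (E-sym e))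
        meets : Meets u (root u)
        -- A state is related to itself only by an actual walk, so a neighbour serves as the
        -- witness.
        meets = choose-∈ (v₀ , true) (Meets u) {v , false} (inj₁ (T-edge (E-sym e) false))
        u≁ : T (root u) (u , false)
        u≁ = [ (λ r → ⊥-elim (¬r r)) , id ]′ meets
        v≁ : ¬ T (root u) (v , true)
        v≁ r with () ← trans (sym (⟦⟧-intro (subst (λ ρ → T ρ (v , true)) root≡ r))) (sym eq)

  module _
    {O : Set} {_≺_ : Rel O 0ℓ} (≺-trans : Transitive _≺_) (≺-irrefl : ∀ {α} → ¬ α ≺ α) (s : ℕ)
    where
    open OddWalks {_≺_ = _≺_} ≺-trans ≺-irrefl s

    -- The double cover has `n + n` states, so its walks can be taken of length at most
    -- `2 ^ (n + n)`, too short for an odd closed one.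
    Adjacent-two-colouring :
      ∀ {V n} → V ↔ Fin n → 2 ^ (n + n) ≤ s → (φ : V → ℕ → O) →
      Σ[ c ∈ (V → Bool) ] (∀ {u v} → Adjacent (φ u) (φ v) → c u ≢ c v)
    Adjacent-two-colouring {V} {n} V↔n small φ =
      two-colouring {E = λ u v → Adjacent (φ u) (φ v)} swap {vs} v∈vs λ v r →
        ¬odd-closed-walk {u = φ v} short (inc r) (walk r)
      where
      open Inverse V↔n using (to; from; strictlyInverseʳ)
      vs : List V
      vs = map from (allFin n)
      v∈vs : ∀ v → v ∈ vs
      v∈vs v = subst (_∈ vs) (strictlyInverseʳ v) (∈-map⁺ from (∈-allFin (to v)))
      E² : Rel (V × Bool) 0ℓ
      E² = double (λ u v → Adjacent (φ u) (φ v))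
      short : 2 ^ length (states vs) ≤ s
      short = subst (λ k → 2 ^ k ≤ s)
        (sym (trans (length-states vs) (cong (λ k → k + k)
          (trans (length-map from (allFin n)) (length-tabulate {n = n} (λ i → i))))))
        small
      inc : ∀ {v b τ} → Reach E² (states vs) (v , b) τ → Drift 1 1 (φ v) (φ v)
      inc {v} r = let (w , _) , e , _ = Reach-head {R = E²} (states vs) r in
        drift-increasing {φ v} {φ w} e
      φ² : V × Bool → (ℕ → O) × Bool
      φ² (v , b) = φ v , b
      walk : ∀ {σ τ} → Reach E² (states vs) σ τ → Walk (2 ^ length (states vs)) (φ² σ) (φ² τ)
      walk = Reach⇒ E² (λ k σ τ → Walk k (φ² σ) (φ² τ)) walk-mono walk-edge walk-trans (states vs)

  -- Null sets and generic sequences.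

  module Ideal
    {O κ : Set} {_≺_ : Rel O 0ℓ} (o : O) (bound : (s : κ → O) → Σ[ β ∈ O ] (∀ k → s k ≺ β))
    where
    open Interleaving _≺_

    private
      height : ∀ {A} → Null _≺_ A → O
      height (empty _)     = o
      height (bounded γ _) = γ

      section : ∀ {A} (N : Null _≺_ A) α → height N ≺ α → Null _≺_ (λ x → A (α ◂ x))
      section (empty ∉A)    α _   = empty λ x → ∉A (α ◂ x)
      section (bounded γ N) α γ≺α = N α γ≺α

      Family : Set₁
      Family = Σ[ A ∈ (κ → (ℕ → O) → Set) ] (∀ k → Null _≺_ (A k))

      head : Family → O
      head (A , N) = proj₁ (bound (λ k → height (N k)))

      next : Family → Family
      next F@(A , N) = (λ k x → A k (head F ◂ x)) ,
        λ k → section (N k) (head F) (proj₂ (bound (λ k → height (N k))) k)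

      -- Each term exceeds the bounds that all members of the family impose at that stage; the
      -- family then passes to its sections at that term.
      generic : Family → ℕ → O
      generic F zero    = head F
      generic F (suc n) = generic (next F) n

      generic-◂ : ∀ (F : Family) → generic F ≡ head F ◂ generic (next F)
      generic-◂ F = ext _ _ λ { zero → refl ; (suc n) → refl }

      section-bounded : ∀ {A γ N N′} → bounded {A = A} γ N ≡ N′ → ∀ α (p : height N′ ≺ α) →
                        ∃ λ γ≺α → N α γ≺α ≡ section N′ α p
      section-bounded refl α p = p , refl

      -- Each term leads one `bounded` further down the derivation, until `empty` is reached. `N` is
      -- a separate argument to make this recursion structural.
      generic-∉ : ∀ (F : Family) k {N} → N ≡ proj₂ F k → ¬ proj₁ F k (generic F)
      generic-∉ F k {empty ∉A}    eq x∈ = ∉A _ x∈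
      generic-∉ F k {bounded γ N} eq x∈ =
        let γ≺α , eq′ = section-bounded eq (head F) (proj₂ (bound (λ k → height (proj₂ F k))) k)
        in generic-∉ (next F) k {N (head F) γ≺α} eq′ (subst (proj₁ F k) (generic-◂ F) x∈)

    -- If all colour classes were null, the generic sequence would avoid even its own.
    Null-pigeonhole : (c : (ℕ → O) → κ) → ∃ λ k → ¬ Null _≺_ (λ x → c x ≡ k)
    Null-pigeonhole c = ¬∀⇒∃¬ λ N → let F = (λ k x → c x ≡ k) , N in
      generic-∉ F (c (generic F)) refl refl

    ¬Null⇒inhabited : ∀ {A} → ¬ Null _≺_ A → ∃ A
    ¬Null⇒inhabited ¬N = by-contradiction λ ¬A → ¬N (empty λ x x∈ → ¬A (x , x∈))

    ¬Null⇒section : ∀ {A} → ¬ Null _≺_ A → ∀ γ → ∃ λ α → γ ≺ α × ¬ Null _≺_ (λ x → A (α ◂ x))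
    ¬Null⇒section ¬N γ = by-contradiction λ ¬∃ →
      ¬N (bounded γ λ α γ≺α → by-contradiction λ ¬N′ → ¬∃ (α , γ≺α , ¬N′))

    -- Each letter fixes the next term of one sequence above the term chosen last, keeping the
    -- section non-null.
    ¬Null-merge : ∀ {A B} → ¬ Null _≺_ A → ¬ Null _≺_ B → ∀ w γ →
                  ∃₂ λ x y → A x × B y × Merge γ w x y
    ¬Null-merge ¬A ¬B [] γ =
      let x , x∈ = ¬Null⇒inhabited ¬A
          y , y∈ = ¬Null⇒inhabited ¬B
      in x , y , x∈ , y∈ , tt
    ¬Null-merge ¬A ¬B (left ∷ w) γ =
      let α , γ≺α , ¬A′ = ¬Null⇒section ¬A γ
          x , y , x∈ , y∈ , m = ¬Null-merge ¬A′ ¬B w α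
      in α ◂ x , y , x∈ , y∈ , γ≺α , m
    ¬Null-merge ¬A ¬B (right ∷ w) γ =
      let α , γ≺α , ¬B′ = ¬Null⇒section ¬B γ
          x , y , x∈ , y∈ , m = ¬Null-merge ¬A ¬B′ w α
      in x , α ◂ y , x∈ , y∈ , γ≺α , m

    -- Every `i` has a colour with non-null class, and two of these colours coincide. The pair is
    -- found before the word, so the word may depend on it.
    monochromatic : {I : Set} (c : I → (ℕ → O) → κ) → ¬ (I ↣ κ) →
      ∃₂ λ i j → i ≢ j × (∀ w γ → ∃₂ λ x y → c i x ≡ c j y × Merge γ w x y)
    monochromatic {I} c ¬I↣κ = by-contradiction λ none → ¬I↣κ $ mk↣ {to = k} λ {i} {j} kᵢ≡kⱼ →
      by-contradiction λ i≢j → none (i , j , i≢j , λ w γ →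
        let x , y , x∈ , y∈ , m = ¬Null-merge (¬N i) (¬N j) w γ
        in x , y , trans x∈ (trans kᵢ≡kⱼ (sym y∈)) , m)
      where
      k : I → κ
      k i = proj₁ (Null-pigeonhole (c i))
      ¬N : ∀ i → ¬ Null _≺_ (λ x → c i x ≡ k i)
      ¬N i = proj₂ (Null-pigeonhole (c i))

  -- Finite chromatic numbers.

  Fin-embeds-or-finite : ∀ (C : Set) j → Fin j ↣ C ⊎ ∃ λ i → i < j × (C ↔ Fin i)
  Fin-embeds-or-finite C zero    = inj₁ (mk↣ {to = λ ()} λ {})
  Fin-embeds-or-finite C (suc j) with Fin-embeds-or-finite C j
  ... | inj₂ (i , i<j , C↔i) = inj₂ (i , m<n⇒m<1+n i<j , C↔i)
  ... | inj₁ f with em 0ℓ {∀ c → ∃ λ i → Injection.to f i ≡ c}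
  ...   | yes onto = inj₂ (j , ≤-refl , mk↔ₛ′ (proj₁ ∘ onto) to
            (λ i → injective (proj₂ (onto (to i)))) (proj₂ ∘ onto))
    where open Injection f using (to; injective)
  ...   | no ¬onto = inj₁ (mk↣ {to = g} λ {i} {j} → g-injective i j)
    where
    open Injection f using (to; injective)
    b = ¬∀⇒∃¬ ¬onto
    g : Fin (suc j) → C
    g zero    = proj₁ b
    g (suc i) = to i
    g-injective : ∀ i j → g i ≡ g j → i ≡ j
    g-injective zero    zero    _  = refl
    g-injective zero    (suc j) eq = ⊥-elim (proj₂ b (j , sym eq))
    g-injective (suc i) zero    eq = ⊥-elim (proj₂ b (i , eq))
    g-injective (suc i) (suc j) eq = cong suc (injective eq)

  -- A set `C` into which `Fin j` does not embed is finite with fewer than `j` elements, so the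
  -- least `j` is minimal among all colour sets.
  finite-χ : ∀ {H K} → Colouring H (Fin K) → ∃ λ j → χ H ≔ Fin j
  finite-χ {H} {K} c = let j , cⱼ , least-j = least (λ j → Colouring H (Fin j)) (K , c) in
    j , cⱼ , λ C col → [ (λ f → f) , (λ (i , i<j , C↔i) →
      ⊥-elim (<⇒≱ i<j (least-j i (recolour {H} (↔⇒↣ C↔i) col)))) ]′ (Fin-embeds-or-finite C j)

  χ-<-intro : ∀ {H j k} → Colouring H (Fin j) → j < k → χ H < k
  χ-<-intro {H} {j} {k} c j<k = let i , χ≔i@(_ , minimal) = finite-χ {H} c
                                    i<k = ≤-<-trans (Fin↣Fin⇒≤ (minimal (Fin j) c)) j<k in
    Fin i , χ≔i , Fin↣Fin (<⇒≤ i<k) , λ k↣i → <⇒≱ i<k (Fin↣Fin⇒≤ k↣i)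

  χ-≥-intro : ∀ {H K k} → Colouring H (Fin K) → ¬ Colouring H (Fin k) → χ H ≥ suc k
  χ-≥-intro {H} {K} {k} c ¬c = let j , χ≔j@(cⱼ , _) = finite-χ {H} c in
    Fin j , χ≔j , Fin↣Fin (≰⇒> λ j≤k → ¬c (recolour {H} (Fin↣Fin j≤k) cⱼ))

  χ-≥⇒¬< : ∀ {H k} → χ H ≥ k → ¬ χ H < k
  χ-≥⇒¬< (κ , (_ , κ-minimal) , k↣κ) (κ′ , (c , _) , _ , ¬k↣κ′) = ¬k↣κ′ (κ-minimal κ′ c ↣-∘ k↣κ)

  -- Compactness for countable graphs.

  module _ {K : ℕ} where

    Infinite : (ℕ → Set) → Set
    Infinite P = ∀ M → ∃ λ N → M ≤ N × P N

    infinite-pigeonhole : ∀ {P} → Infinite P → (g : ℕ → Fin K) →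
                          ∃ λ k → Infinite (λ N → P N × g N ≡ k)
    infinite-pigeonhole {P} inf g = by-contradiction λ none →
      let last : ∀ k → ∃ λ M → ∀ N → M ≤ N → P N → g N ≢ k
          last k = let M , ¬N = ¬∀⇒∃¬ (λ infₖ → none (k , infₖ)) in
            M , λ N M≤N PN gN≡k → ¬N (N , M≤N , PN , gN≡k)
          L , last< = bounded-Fin (proj₁ ∘ last)
          N , L≤N , PN = inf L
      in proj₂ (last (g N)) N (≤-trans (<⇒≤ (last< (g N))) L≤N) PN refl

    -- `stage n` is an infinite set of `N` whose colourings agree on the vertices below `n`. The
    -- limit takes the common colours, and each edge is checked in one colouring of a late stage.
    compactness : (E : Rel ℕ 0ℓ) →
      (∀ N → Σ[ c ∈ (ℕ → Fin K) ] (∀ a b → a < N → b < N → E a b → c a ≢ c b)) →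
      Σ[ c ∈ (ℕ → Fin K) ] (∀ a b → E a b → c a ≢ c b)
    compactness E finite = limit , proper
      where
      c : ℕ → ℕ → Fin K
      c N = proj₁ (finite N)

      stage : ℕ → Σ[ P ∈ (ℕ → Set) ] Infinite P
      next  : ∀ n → ∃ λ k → Infinite (λ N → proj₁ (stage n) N × c N n ≡ k)
      stage zero    = (λ _ → ⊤) , λ M → M , ≤-refl , tt
      stage (suc n) = _ , proj₂ (next n)
      next n = infinite-pigeonhole (proj₂ (stage n)) (λ N → c N n)

      limit : ℕ → Fin K
      limit n = proj₁ (next n)

      agrees : ∀ {n N a} → proj₁ (stage n) N → a <′ n → c N a ≡ limit a
      agrees (_ , eq) <′-base       = eq
      agrees (P , _)  (≤′-step a<n) = agrees P a<n

      proper : ∀ a b → E a b → limit a ≢ limit b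
      proper a b e eq =
        let n = suc (a + b)
            N , n≤N , P = proj₂ (stage n) n
            a<n = s≤s (m≤m+n a b)
            b<n = s≤s (m≤n+m b a)
        in proj₂ (finite N) a b (≤-trans a<n n≤N) (≤-trans b<n n≤N) e
             (trans (agrees P (≤⇒≤′ a<n)) (trans eq (sym (agrees P (≤⇒≤′ b<n)))))

  module _ (G : Graph) (vert : ℕ → Vertex G) where
    open Graph G using (_~_; ~-sym)

    -- Membership is a Boolean equation, hence irrelevant. The order need not be `N`, as `vert` may
    -- repeat.
    first : ℕ → Subgraph G
    first N = record
      { _∈V    = λ u → ⟦ (∃ λ a → a < N × vert a ≡ u) ⟧ ≡ true
      ; ∈V-irr = ≡-irrelevant
      ; _~′_   = λ u v → proj₁ u ~ proj₁ v
      ; ~′⇒~   = λ e → e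
      ; ~′-sym = ~-sym
      }

    first-finite : ∀ N → ∃ λ m → HasOrder (graph (first N)) m
    first-finite N with Fin-embeds-or-finite (Vertex (graph (first N))) (suc N)
    ... | inj₂ (m , _ , V↔m) = m , V↔m
    ... | inj₁ i = ⊥-elim (1+n≰n (Fin↣Fin⇒≤ {suc N} {N} (mk↣ {to = λ u → fromℕ< (<N (to u))}
        λ {u} {v} eq → injective (vertex≡ (trans (sym (vert-index (to u)))
          (trans (cong vert (fromℕ<-injective _ _ _ _ eq)) (vert-index (to v))))))))
      where
      open Injection i using (to; injective)
      open Subgraph (first N) using (_∈V)
      V : Set
      V = Vertex (graph (first N))
      index : (u : V) → ∃ λ a → a < N × vert a ≡ proj₁ u
      index (_ , u∈) = ⟦⟧-elim u∈
      <N : (u : V) → proj₁ (index u) < N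
      <N u = proj₁ (proj₂ (index u))
      vert-index : (u : V) → vert (proj₁ (index u)) ≡ proj₁ u
      vert-index u = proj₂ (proj₂ (index u))
      vertex≡ : {u v : V} → proj₁ u ≡ proj₁ v → u ≡ v
      vertex≡ {u , p} {.u , q} refl = cong (u ,_) (≡-irrelevant p q)

    finite-subgraph : ∀ {K} → (∀ (c : ℕ → Fin (suc K)) → ∃₂ λ a b → vert a ~ vert b × c a ≡ c b) →
                      ∃ (HasSubgraph G (suc (suc K)))
    finite-subgraph {K} ¬colourable =
      let N , ¬col = ¬∀⇒∃¬ λ finite →
            let c , proper = compactness (λ a b → vert a ~ vert b) (extend finite)
                a , b , e , eq = ¬colourable c
            in proper a b e eq
          m , V↔m = first-finite N
      in m , first N , V↔m , χ-≥-intro {graph (first N)} (injective-colouring V↔m) ¬col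
      where
      injective-colouring : ∀ {N m} → HasOrder (graph (first N)) m →
                            Colouring (graph (first N)) (Fin m)
      injective-colouring {N} V↔m = Injection.to (↔⇒↣ V↔m) ,
        λ e eq → Graph.~-irrefl (graph (first N)) (Injection.injective (↔⇒↣ V↔m) eq) e
      extend : (∀ N → Colouring (graph (first N)) (Fin (suc K))) →
        ∀ N → Σ[ c ∈ (ℕ → Fin (suc K)) ] (∀ a b → a < N → b < N → vert a ~ vert b → c a ≢ c b)
      extend finite N = c , λ a b a<N b<N e eq →
        proj₂ (finite N) {vert a , in-first a<N} {vert b , in-first b<N} e
          (trans (sym (c-in a<N)) (trans eq (c-in b<N)))
        where
        open Subgraph (first N) using (_∈V)
        in-first : ∀ {a} → a < N → vert a ∈V
        in-first {a} a<N = ⟦⟧-intro (a , a<N , refl)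
        c : ℕ → Fin (suc K)
        c a with em 0ℓ {vert a ∈V}
        ... | yes a∈ = proj₁ (finite N) (vert a , a∈)
        -- A default colour, available because the colours are `Fin (suc K)`.
        ... | no _   = zero
        c-in : ∀ {a} (a<N : a < N) → c a ≡ proj₁ (finite N) (vert a , in-first a<N)
        c-in {a} a<N with em 0ℓ {vert a ∈V}
        ... | yes a∈ = cong (λ p → proj₁ (finite N) (vert a , p)) (≡-irrelevant a∈ (in-first a<N))
        ... | no a∉  = ⊥-elim (a∉ (in-first a<N))

  -- Codes for sequences, and reals for ordinals.

  list : ℕ → List ℕ
  list n = choose [] λ l → encode l ≡ n

  list-encode : ∀ l → list (encode l) ≡ l
  list-encode l = encode-injective (choose-∈ [] (λ k → encode k ≡ encode l) {l} refl)

  ι : ℕ → Ω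
  ι zero    = ⟨ leaf ⟩
  ι (suc n) = proj₁ (<Ω-bound (λ _ → ι n))

  ι-mono : ∀ {m n} → m < n → ι m <Ω ι n
  ι-mono m<n = go (≤⇒≤′ m<n)
    where
    ι< : ∀ n → ι n <Ω ι (suc n)
    ι< n = proj₂ (<Ω-bound (λ _ → ι n)) 0
    go : ∀ {m n} → m <′ n → ι m <Ω ι n
    go {m} <′-base = ι< m
    go {m} {suc n} (≤′-step m<n) = <Ω-trans {ι m} {ι n} {ι (suc n)} (go m<n) (ι< n)

  ι-injective : ∀ {m n} → ι m ≡ ι n → m ≡ n
  ι-injective {m} {n} eq with <-cmp m n
  ... | tri< m<n _ _ = ⊥-elim (<Ω-irrefl {ι n} (subst (_<Ω ι n) eq (ι-mono m<n)))
  ... | tri≈ _ m≡n _ = m≡n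
  ... | tri> _ _ n<m = ⊥-elim (<Ω-irrefl {ι n} (subst (ι n <Ω_) eq (ι-mono n<m)))

  Cantor : ¬ ((2^ ℕ) ↣ ℕ)
  Cantor i = D∌ (⟦⟧-intro {Diag (to D)} (D , refl , ¬-not D∌))
    where
    open Injection i using (to; injective)
    Diag : ℕ → Set
    Diag n = ∃ λ (S : 2^ ℕ) → to S ≡ n × S n ≡ false
    D : 2^ ℕ
    D n = ⟦ Diag n ⟧
    D∌ : D (to D) ≢ true
    D∌ eq with S , to-S , Sn ← ⟦⟧-elim {Diag (to D)} eq with refl ← injective to-S
      with () ← trans (sym eq) Sn

  abstract
    Ω↣2^ℕ : Ω ↣ (2^ ℕ)
    Ω↣2^ℕ = ℵ₁-embeds Cantor ↣-∘ mk↣ {to = _, 0} (cong proj₁)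

  bit : Ω → ℕ → Bool
  bit = Injection.to Ω↣2^ℕ

  separating-bit : ∀ {α β} → α ≢ β → ∃ λ n → bit α n ≢ bit β n
  separating-bit α≢β = ¬∀⇒∃¬ λ same → α≢β (Injection.injective Ω↣2^ℕ (ext _ _ same))

  -- There are only 2^ℵ₀ sequences in `Ω`. Subsets of `ℵ₁` with the same decoding become twins in
  -- the graph, which raises its order to 2^ℵ₁.
  decode : 2^ ℵ₁ → ℕ → Ω
  decode S n = choose ⟨ leaf ⟩ λ α → S (α , n) ≡ true

  code : (ℕ → Ω) → 2^ ℵ₁
  code x (α , n) = ⟦ x n ≡ α ⟧

  decode-code : ∀ x → decode (code x) ≡ x
  decode-code x = ext _ _ λ n → sym (⟦⟧-elim
    (choose-∈ ⟨ leaf ⟩ (λ α → code x (α , n) ≡ true) {x n} (⟦⟧-intro {x n ≡ x n} refl)))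

  -- The graph and its chromatic number.

  module Construction (shift : ℕ → ℕ) where
    open Interleaving _<Ω_

    Merged : ℕ → Rel (ℕ → Ω) 0ℓ
    Merged n x y = ∃ λ γ → Merge γ (weaves shift (suc n)) x y

    -- The first term of a sequence only serves to give it a real.

    Joined : ℕ → Rel (ℕ → Ω) 0ℓ
    Joined n x y = bit (x 0) n ≢ bit (y 0) n ×
                   (Merged n (drop 1 x) (drop 1 y) ⊎ Merged n (drop 1 y) (drop 1 x))

    G : Graph
    G = record
      { Vertex   = 2^ ℵ₁
      ; _~_      = λ u v → ∃ λ n → Joined n (decode u) (decode v)
      ; ~-sym    = λ (n , b , m) → n , b ∘ sym , swap m
      ; ~-irrefl = λ { refl (n , b , _) → b refl }
      }

    open Graph G using (_~_)

    code-~ : ∀ {x y n} → Joined n x y → code x ~ code y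
    code-~ {x} {y} {n} j = n , subst₂ (Joined n) (sym (decode-code x)) (sym (decode-code y)) j

    -- A bit that separates the reals of the first terms separates the first terms.
    colouring : Colouring G ℵ₁
    colouring = (λ u → decode u 0 , 0) , λ (n , b , _) eq → b (cong (λ α → bit (proj₁ α) n) eq)

    code-◂-~ : ∀ {α β n γ x y} → bit α n ≢ bit β n → Merge γ (weaves shift (suc n)) x y →
               code (α ◂ x) ~ code (β ◂ y)
    code-◂-~ {α} {β} {n} {γ} {x} {y} b m = code-~ {α ◂ x} {β ◂ y} {n} (b , inj₁ (γ , m))

    ¬countably-colourable : (c : 2^ ℵ₁ → ℕ) → ∃₂ λ u v → u ~ v × c u ≡ c v
    ¬countably-colourable c =
      let α , β , α≢β , merge = Ideal.monochromatic {κ = ℕ} {_<Ω_} ⟨ leaf ⟩ <Ω-bound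
            (λ α x → c (code (α ◂ x)))
            (λ i → Ω-uncountable (Injection.to i) (Injection.injective i))
          n , b = separating-bit α≢β
          x , y , same , m = merge (weaves shift (suc n)) ⟨ leaf ⟩
      in code (α ◂ x) , code (β ◂ y) , code-◂-~ b m , same

    uncountable : ∀ {C} → Colouring G C → ¬ (C ↣ ℕ)
    uncountable (c , proper) C↣ℕ =
      let u , v , u~v , same = ¬countably-colourable (Injection.to C↣ℕ ∘ c)
      in proper {u} {v} u~v (Injection.injective C↣ℕ same)

    χ-G : χ G ≔ ℵ₁
    χ-G = colouring , λ C col → ℵ₁-embeds (uncountable col)

    -- Countably many vertices for `compactness`: sequences of finite ordinals that end in `ι 0`
    -- repeated.
    vert : ℕ → 2^ ℵ₁
    vert a = code (ι ∘ nth (list a))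

    -- `Ideal` applies to ℕ here because finitely many numbers have a bound; the `suc K` first terms
    -- are one more than the colours.
    ¬finitely-colourable : ∀ {K} (c : ℕ → Fin K) → ∃₂ λ a b → vert a ~ vert b × c a ≡ c b
    ¬finitely-colourable {K} c =
      let i , j , i≢j , merge = monochromatic (λ i x → c (name i x))
            (λ i → 1+n≰n (Fin↣Fin⇒≤ i))
          x , y , same , m = merge (word i j) 0
      in name i x , name j y , joined i≢j m , same
      where
      open Ideal {κ = Fin K} {_<_} 0 bounded-Fin

      separator : (i j : Fin (suc K)) → ∃ λ n → i ≢ j → bit (ι (toℕ i)) n ≢ bit (ι (toℕ j)) n
      separator i j with em 0ℓ {i ≡ j}
      -- The default on the diagonal lets `longest` range over all pairs.
      ... | yes i≡j = 0 , λ i≢j → ⊥-elim (i≢j i≡j)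
      ... | no i≢j = map₂ (λ b _ → b) (separating-bit (i≢j ∘ toℕ-injective ∘ ι-injective))

      word : (i j : Fin (suc K)) → Word
      word i j = weaves shift (suc (proj₁ (separator i j)))

      longest : (i : Fin (suc K)) → ∃ λ N → ∀ j → length (word i j) < N
      longest i = bounded-Fin λ j → length (word i j)

      -- The cut-off for sequences is fixed before the pair `i`, `j` is known, so it must cover the
      -- words of all pairs.
      L : ∃ λ N → ∀ i → proj₁ (longest i) < N
      L = bounded-Fin (proj₁ ∘ longest)

      word< : ∀ i j → length (word i j) ≤ proj₁ L
      word< i j = ≤-trans (<⇒≤ (proj₂ (longest i) j)) (<⇒≤ (proj₂ L i))

      name : Fin (suc K) → (ℕ → ℕ) → ℕ
      name i x = encode (toℕ i ∷ prefix (proj₁ L) x)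

      joined : ∀ {i j x y} → i ≢ j → Interleaving.Merge _<_ 0 (word i j) x y →
               vert (name i x) ~ vert (name j y)
      joined {i} {j} {x} {y} i≢j m = code-~ {ι ∘ nth (list (name i x))}
        {ι ∘ nth (list (name j y))} {n} (subst₂ (Joined n) (seq i x) (seq j y)
        ( proj₂ (separator i j) i≢j
        , inj₁ (ι 0 , Merge-cong (word i j) (near x) (near y) (Merge-map ι ι-mono (word i j) m))))
        where
        n : ℕ
        n = proj₁ (separator i j)
        seq : ∀ i x → ι ∘ nth (toℕ i ∷ prefix (proj₁ L) x) ≡ ι ∘ nth (list (name i x))
        seq i x = cong (λ l → ι ∘ nth l) (sym (list-encode (toℕ i ∷ prefix (proj₁ L) x)))
        near : ∀ x k → k < length (word i j) → ι (x k) ≡ ι (nth (prefix (proj₁ L) x) k)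
        near x k k< = cong ι (sym (nth-prefix x (≤-trans k< (word< i j))))

    -- Colouring small subgraphs.

    module Growth
      (f : ℕ → ℕ)
      (large : ∀ m {k n} → k ≤ 2 ^ suc (suc m) → n < f k → 2 ^ (n + n) ≤ shift m)
      where
      small-colouring : ∀ {k} (H : Subgraph G) n → 3 ≤ k → HasOrder (graph H) n → n < f k →
                        ∃ λ j → j < k × Colouring (graph H) (Fin j)
      small-colouring {k} H n 3≤k V↔n n<fk =
        2 ^ m * 2 , subst (_< k) (*-comm 2 (2 ^ m)) 2^m+1<k , colour , λ {u} {v} → proper {u} {v}
        where
        open Subgraph H using (_~′_; ~′⇒~)
        V : Set
        V = Vertex (graph H)
        m : ℕ
        m = proj₁ (dyadic k 3≤k)
        2^m+1<k : 2 ^ suc m < k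
        2^m+1<k = proj₁ (proj₂ (dyadic k 3≤k))
        seq : V → ℕ → Ω
        seq (u , _) = decode u
        open Walks (λ {α} {β} {γ} → <Ω-trans {α} {β} {γ}) (λ {α} → <Ω-irrefl {α}) (shift m)
          using (Adjacent)
        -- After `skip shift m`, every edge of index at least `m` is `Adjacent` for the single shift
        -- `shift m`.
        parities : Σ[ c ∈ (V → Bool) ] (∀ {u v} →
          Adjacent (skip shift m (drop 1 (seq u))) (skip shift m (drop 1 (seq v))) → c u ≢ c v)
        parities = Adjacent-two-colouring {_≺_ = _<Ω_}
          (λ {α} {β} {γ} → <Ω-trans {α} {β} {γ}) (λ {α} → <Ω-irrefl {α}) (shift m) V↔n
          (large m (proj₂ (proj₂ (dyadic k 3≤k))) n<fk) (λ u → skip shift m (drop 1 (seq u)))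
        toFin : Bool ↣ Fin 2
        toFin = ↔⇒↣ (↔-sym 2↔Bool)
        bits : V → Fin m → Fin 2
        bits u i = Injection.to toFin (bit (seq u 0) (toℕ i))
        colour : V → Fin (2 ^ m * 2)
        colour u = combine (funToFin (bits u)) (Injection.to toFin (proj₁ parities u))
        same-bit : ∀ u v {i} → colour u ≡ colour v → i < m → bit (seq u 0) i ≡ bit (seq v 0) i
        same-bit u v eq i<m = subst (λ i → bit (seq u 0) i ≡ bit (seq v 0) i) (toℕ-fromℕ< i<m)
          (Injection.injective toFin (trans (sym (finToFun-funToFin (bits u) (fromℕ< i<m)))
            (trans (cong (λ c → finToFun c (fromℕ< i<m))
                     (proj₁ (combine-injective (funToFin (bits u)) _ (funToFin (bits v)) _ eq)))
              (finToFun-funToFin (bits v) (fromℕ< i<m)))))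
        same-parity : ∀ u v → colour u ≡ colour v → proj₁ parities u ≡ proj₁ parities v
        same-parity u v eq = Injection.injective toFin
          (proj₂ (combine-injective (funToFin (bits u)) _ (funToFin (bits v)) _ eq))
        shifted : ∀ {i x y} → m ≤ i → Merged i x y →
                  Shifted (shift m) (skip shift m x) (skip shift m y)
        shifted m≤i (_ , w) = Merge-weaves shift (s≤s m≤i) w
        proper : ∀ {u v} → u ~′ v → colour u ≢ colour v
        proper {u} {v} e eq =
          let i , bit≢ , merged = ~′⇒~ e in
          [ (λ i<m → bit≢ (same-bit u v eq i<m))
          , (λ m≤i → proj₂ parities {u} {v} ([ inj₁ ∘ shifted m≤i , inj₂ ∘ shifted m≤i ]′ merged)
                       (same-parity u v eq)) ]′ (<-≤-connex i m)

      small-χ : ∀ {k} → 3 ≤ k → ∀ (H : Subgraph G) n → HasOrder (graph H) n → n < f k → χ graph H < k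
      small-χ 3≤k H n V↔n n<fk =
        let j , j<k , c = small-colouring H n 3≤k V↔n n<fk in χ-<-intro {graph H} c j<k

      growth : ∀ k → 3 ≤ k → ∃[ m ] (f[ G ] k ≔ m) × f k ≤ m
      growth (suc zero)    (s≤s ())
      growth (suc (suc k)) 3≤k =
        let m , H@(S , V↔m , χ≥) , minimal = least (HasSubgraph G (suc (suc k)))
              (finite-subgraph G vert ¬finitely-colourable)
        in m , (H , minimal) , ≮⇒≥ λ m<fk → χ-≥⇒¬< {graph S} χ≥ (small-χ 3≤k S m V↔m m<fk)

theoremA : (∀ ℓ → ExcludedMiddle ℓ) →
    (∀ a b → Extensionality a b) →
    (f : ℕ → ℕ) →
    Σ[ ℵ₁ ∈ Set ] IsAleph₁ ℵ₁ ×
    (Σ[ G ∈ Graph ]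
    (Vertex G ↔ (2^ ℵ₁)) ×
    (χ G ≔ ℵ₁) ×
    (∀ k → 3 ≤ k →
    (∃[ m ] (f[ G ] k ≔ m) × f k ≤ m) ×
    (∀ (H : Subgraph G) n → HasOrder (graph H) n → n < f k → χ graph H < k)))
theoremA em ext f =
  ℵ₁ , ℵ₁-isAleph₁ , G , ↔-id _ , χ-G , λ k 3≤k → growth k 3≤k , small-χ 3≤k
  where
  open Classical em ext

  -- The sum dominates `f k` for every `k` that `dyadic` sends to `m`; the shift below then bounds
  -- walks in the double cover.
  bound : ℕ → ℕ
  bound m = sumUpTo f (2 ^ suc (suc m))

  open Construction (λ m → 2 ^ (bound m + bound m))

  large : ∀ m {k n} → k ≤ 2 ^ suc (suc m) → n < f k →
          2 ^ (n + n) ≤ 2 ^ (bound m + bound m)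
  large m k≤ n<fk = ^-monoʳ-≤ 2 (+-mono-≤ n≤ n≤)
    where n≤ = ≤-trans (<⇒≤ n<fk) (≤-sumUpTo f (≤⇒≤′ k≤))

  open Growth f large
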